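{- For all $n \ge 1$, the median Genocchi number $h_n$ equals the number of permutations $\sigma$ of $[2n]$ such that for every $i\in[2n-1]$ with $\sigma(i)>\sigma(i+1)$, the value $\sigma(i)$ is even and $\sigma(i+1)$ is odd.
   Context: A Dumont derangement is a permutation $\sigma\in\mathfrak S_{2N}$ with $2i>\sigma(2i)$ and $2i-1<\sigma(2i-1)$ for all $i=1,\dots,N$. For $n\ge 0$, the median Genocchi number $h_n$ is the number of Dumont derangements in $\mathfrak S_{2n+2}$. -}

module Defs where

open import Data.Nat using (ℕ; zero; suc; _+_; _*_; _<ᵇ_; _≡ᵇ_)
open import Data.Nat.Base using (_%_)
open import Data.Bool using (Bool; true; false; _∧_; not; T)
open import Data.Fin using (Fin; toℕ)
open import Data.Fin.Properties using (_≟_)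
open import Data.Vec using (Vec; lookup; allFin)
open import Data.Vec.Relation.Unary.All using (all?)
open import Data.Product using (Σ; _×_)
open import Relation.Nullary.Decidable using (⌊_⌋)
open import Function.Bundles using (_↔_)

-- A permutation of [m] (values 1..m encoded as Fin m, i.e. 0..m-1) is given
-- by its one-line notation: a vector v of length m with v[i] = σ(i+1)-1,
-- all of whose entries are distinct (hence bijective, by finiteness).
-- Properties are Boolean-valued (wrapped in T) so that proofs are unique and
-- the subtypes below are honest finite sets of permutations.

allB : {A : Set} → (A → Bool) → {n : ℕ} → Vec A n → Bool
allB p Vec.[] = true
allB p (x Vec.∷ xs) = p x ∧ allB p xs

distinct : {m n : ℕ} → Vec (Fin m) n → Bool
distinct Vec.[] = true
distinct (x Vec.∷ xs) = allB (λ y → not ⌊ x ≟ y ⌋) xs ∧ distinct xs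

isPerm : {m : ℕ} → Vec (Fin m) m → Bool
isPerm v = distinct v

PermsWith : (m : ℕ) → (Vec (Fin m) m → Bool) → Set
PermsWith m P = Σ (Vec (Fin m) m) (λ v → T (isPerm v ∧ P v))

val : {m : ℕ} → Vec (Fin m) m → Fin m → ℕ
val v i = suc (toℕ (lookup v i))

pos : {m : ℕ} → Fin m → ℕ
pos i = suc (toℕ i)

even : ℕ → Bool
even k = (k % 2) ≡ᵇ 0

odd : ℕ → Bool
odd k = not (even k)

isDumontDerangement : {m : ℕ} → Vec (Fin m) m → Bool
isDumontDerangement {m} v = allB cond (allFin m)
  where
  cond : Fin m → Bool
  cond i with even (pos i)
  ... | true  = val v i <ᵇ pos i
  ... | false = pos i <ᵇ val v i

descentsEvenOdd : {m : ℕ} → Vec (Fin m) m → Bool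
descentsEvenOdd {zero} Vec.[] = true
descentsEvenOdd {suc m} v = go (Data.Vec.toList v)
  where
  open import Data.List using (List; []; _∷_)
  go : List (Fin (suc m)) → Bool
  go [] = true
  go (x ∷ []) = true
  go (x ∷ y ∷ rest) =
    (if (suc (toℕ y) <ᵇ suc (toℕ x)) then (even (suc (toℕ x)) ∧ odd (suc (toℕ y))) else true)
    ∧ go (y ∷ rest)
    where open import Data.Bool using (if_then_else_)

DumontDerangements : (N : ℕ) → Set
DumontDerangements N = PermsWith (2 * N) isDumontDerangement

-- h_n = #Dumont derangements in S_{2n+2}.  "h_n = #X" is expressed as a
-- bijection between the (finite) set X and the set of Dumont derangements
-- in S_{2n+2}.
HasCardinality-h : (n : ℕ) → Set → Set
HasCardinality-h n X = X ↔ DumontDerangements (suc n)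

EvenOddDescentPerms : (n : ℕ) → Set
EvenOddDescentPerms n = PermsWith (2 * n) descentsEvenOdd

{-# OPTIONS --safe #-}

-- Both numbers are permanents of 0/1 boards. Words whose descents are all
-- even-odd are Hamiltonian paths in the graph of admissible neighbours;
-- Foata's transformation turns them into permutations of [2n] whose drops
-- x > σ(x) are all even-odd, that is, into the permanent of the same board.
-- In a Dumont derangement of [2n+2] the positions 2 and 2n+1 are forced,
-- and what remains is, up to relabelling, the board of [2n] with σ(x) ≤ x
-- at even x and σ(x) ≥ x at odd x. The two boards on [2n] are compared by
-- processing rows and columns 1, 2, ... simultaneously: if s is the number
-- of rows (equivalently, columns) still to be matched with later indices,
-- an odd index either raises s (in one way) or keeps it (in s + 1 ways), and
-- an even index either keeps it (s + 1 ways) or lowers it (s² ways), on both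
-- boards.

module Submission where

open import Defs
open import Data.Bool using (Bool; true; false; _∧_; not; T; if_then_else_)
open import Data.Bool.Properties using (∧-identityʳ; ∧-zeroʳ)
open import Data.Empty using (⊥-elim)
open import Data.Fin using (Fin; zero; suc; toℕ)
open import Data.Fin.Properties using (0↔⊥; 1↔⊤; +↔⊎; _≟_)
open import Data.List
  using (List; []; _∷_; _++_; map; replicate; length; tabulate; allFin)
open import Data.List.Properties
  using (++-identityʳ; length-tabulate; map-tabulate; map-cong; map-id)
open import Data.List.Relation.Binary.Permutation.Propositional
  using (_↭_; refl; prep; swap; trans; ↭-sym)
open import Data.List.Relation.Binary.Permutation.Propositional.Properties
  using (shift; ¬x∷xs↭[])
open import Data.List.Relation.Unary.All as All using (All; []; _∷_)
import Data.List.Relation.Unary.All.Properties as All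
open import Data.List.Relation.Unary.AllPairs using (AllPairs; []; _∷_)
open import Data.List.Relation.Unary.Unique.Propositional using (Unique)
open import Data.List.Relation.Unary.Unique.Propositional.Properties using (allFin⁺)
open import Data.Maybe using (Maybe; just; nothing)
open import Data.Nat using (ℕ; zero; suc; _+_; _*_; _<_; _≤_; _<ᵇ_; _≥_; s≤s)
open import Data.Nat.ListAction using (sum)
open import Data.Nat.Properties hiding (_≟_)
open import Data.Nat.Tactic.RingSolver using (solve-∀)
open import Data.Product using (Σ; _×_; _,_; proj₁; proj₂)
open import Data.Sum using (_⊎_; inj₁; inj₂)
open import Data.Sum.Function.Propositional using (_⊎-↔_)
open import Data.Vec as Vec using (Vec; []; _∷_; lookup; toList)
open import Function using (_∘_; flip; id)
open import Function.Bundles using (_↔_; mk↔ₛ′)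
open import Function.Properties.Inverse using (↔-refl; ↔-sym; ↔-trans)
open import Relation.Binary.PropositionalEquality as ≡
  using (_≡_; _≢_; refl; sym; cong; cong₂; subst; subst₂; module ≡-Reasoning)
open import Relation.Nullary using (yes; no)
open import Relation.Nullary.Decidable using (⌊_⌋)
open ≡-Reasoning

private
  variable
    A B A′ B′ : Set
    m n : ℕ

-- Sums over the choice of one entry of a list.

data Pick {A : Set} (x : A) : List A → List A → Set where
  here  : ∀ {xs} → Pick x xs (x ∷ xs)
  there : ∀ {y xs ys} → Pick x ys xs → Pick x (y ∷ ys) (y ∷ xs)

Pick-↭ : ∀ {x : A} {ys xs} → Pick x ys xs → xs ↭ x ∷ ys
Pick-↭ here                = refl
Pick-↭ (there {y = y} p) = trans (prep y (Pick-↭ p)) (swap y _ refl)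

Pick-length : ∀ {x : A} {ys xs} → Pick x ys xs → length xs ≡ suc (length ys)
Pick-length here      = refl
Pick-length (there p) = cong suc (Pick-length p)

Pick-All : ∀ {P : A → Set} {x ys xs} → Pick x ys xs → All P xs → P x × All P ys
Pick-All here      (px ∷ pxs) = px , pxs
Pick-All (there p) (py ∷ pxs) with px , pys ← Pick-All p pxs = px , py ∷ pys

Pick-AllPairs : ∀ {R : A → A → Set} {x ys xs} → Pick x ys xs → AllPairs R xs → AllPairs R ys
Pick-AllPairs here      (_ ∷ rs) = rs
Pick-AllPairs (there p) (r ∷ rs) = proj₂ (Pick-All p r) ∷ Pick-AllPairs p rs

pickSum : (A → List A → ℕ) → List A → ℕ
pickSum f []       = 0
pickSum f (x ∷ xs) = f x xs + pickSum (λ y ys → f y (x ∷ ys)) xs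

pickSum-cong : ∀ {f g : A → List A → ℕ} xs →
               (∀ {x ys} → Pick x ys xs → f x ys ≡ g x ys) → pickSum f xs ≡ pickSum g xs
pickSum-cong []       eq = refl
pickSum-cong (x ∷ xs) eq = cong₂ _+_ (eq here) (pickSum-cong xs (eq ∘ there))

pickSum-zero : ∀ (xs : List A) → pickSum (λ _ _ → 0) xs ≡ 0
pickSum-zero []       = refl
pickSum-zero (x ∷ xs) = pickSum-zero xs

pickSum-+ : ∀ (f g : A → List A → ℕ) xs →
            pickSum (λ x ys → f x ys + g x ys) xs ≡ pickSum f xs + pickSum g xs
pickSum-+ f g []       = refl
pickSum-+ f g (x ∷ xs) = begin
  (f x xs + g x xs) + pickSum (λ y ys → f y (x ∷ ys) + g y (x ∷ ys)) xs
    ≡⟨ cong (f x xs + g x xs +_) (pickSum-+ (λ y → f y ∘ (x ∷_)) (λ y → g y ∘ (x ∷_)) xs) ⟩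
  (f x xs + g x xs) + (pickSum (λ y ys → f y (x ∷ ys)) xs + pickSum (λ y ys → g y (x ∷ ys)) xs)
    ≡⟨ interchange (f x xs) _ _ _ ⟩
  pickSum f (x ∷ xs) + pickSum g (x ∷ xs) ∎
  where
  interchange : ∀ a b c d → (a + b) + (c + d) ≡ (a + c) + (b + d)
  interchange = solve-∀

pickSum-*ˡ : ∀ k (f : A → List A → ℕ) xs →
             k * pickSum f xs ≡ pickSum (λ x ys → k * f x ys) xs
pickSum-*ˡ k f []       = *-zeroʳ k
pickSum-*ˡ k f (x ∷ xs) = ≡.trans (*-distribˡ-+ k (f x xs) _)
  (cong (k * f x xs +_) (pickSum-*ˡ k (λ y → f y ∘ (x ∷_)) xs))

pickSum-comm : ∀ (F : A → List A → B → List B → ℕ) xs ys →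
  pickSum (λ x xs′ → pickSum (F x xs′) ys) xs ≡
  pickSum (λ y ys′ → pickSum (λ x xs′ → F x xs′ y ys′) xs) ys
pickSum-comm F []       ys = sym (pickSum-zero ys)
pickSum-comm F (x ∷ xs) ys = ≡.trans
  (cong (pickSum (F x xs) ys +_) (pickSum-comm (λ x′ → F x′ ∘ (x ∷_)) xs ys))
  (sym (pickSum-+ (F x xs) (λ y ys′ → pickSum (λ x′ xs′ → F x′ (x ∷ xs′) y ys′) xs) ys))

pickSum-↭ : ∀ {f : A → List A → ℕ} {xs ys} →
            (∀ {x us vs} → us ↭ vs → f x us ≡ f x vs) → xs ↭ ys → pickSum f xs ≡ pickSum f ys
pickSum-↭ resp refl         = refl
pickSum-↭ resp (prep x p)   = cong₂ _+_ (resp p) (pickSum-↭ (resp ∘ prep x) p)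
pickSum-↭ {f = f} resp (swap {xs} {ys} x y p) = ≡.trans
  (cong₂ _+_ (resp (prep y p)) (cong₂ _+_ (resp (prep x p))
    (≡.trans (pickSum-↭ (resp ∘ prep x ∘ prep y) p)
             (pickSum-cong ys λ _ → resp (swap x y refl)))))
  (exchange (f x (y ∷ ys)) (f y (x ∷ ys)) _)
  where
  exchange : ∀ a b c → a + (b + c) ≡ b + (a + c)
  exchange = solve-∀
pickSum-↭ resp (trans p q)  = ≡.trans (pickSum-↭ resp p) (pickSum-↭ resp q)

pickSum-map : ∀ (g : A → B) (f : B → List B → ℕ) xs →
              pickSum f (map g xs) ≡ pickSum (λ x ys → f (g x) (map g ys)) xs
pickSum-map g f []       = refl
pickSum-map g f (x ∷ xs) = cong (f (g x) (map g xs) +_) (pickSum-map g (λ y → f y ∘ (g x ∷_)) xs)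

-- In a sweep the lines carried over are equal entries of a list; the factor `suc s` is what becomes
-- the number of ways in the recurrences.
pickSum-replicate : ∀ (f : A → List A → ℕ) s a xs →
  pickSum f (replicate (suc s) a ++ xs) ≡
  suc s * f a (replicate s a ++ xs) + pickSum (λ y ys → f y (replicate (suc s) a ++ ys)) xs
pickSum-replicate f zero    a xs = cong (_+ pickSum (λ y → f y ∘ (a ∷_)) xs) (sym (*-identityˡ (f a xs)))
pickSum-replicate f (suc s) a xs = ≡.trans
  (cong (f a (a ∷ replicate s a ++ xs) +_) (pickSum-replicate (λ y → f y ∘ (a ∷_)) s a xs))
  (sym (+-assoc (f a (a ∷ replicate s a ++ xs)) _ _))

-- Permanents.

-- The permanent of the matrix (R r c) with rows rs and columns cs; it is 0
-- when the lengths of the two lists differ.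
per : (A → B → ℕ) → List A → List B → ℕ
per R []       []       = 1
per R []       (_ ∷ _)  = 0
per R (r ∷ rs) cs       = pickSum (λ c cs′ → R r c * per R rs cs′) cs

-- The first row takes `c` itself, or it takes another column and leaves `c` to a later row, where
-- the induction applies. Interchanging the two choices in the second case collects the terms by the
-- row that takes `c`.
per-column : ∀ (R : A → B → ℕ) rs c cs →
             per R rs (c ∷ cs) ≡ pickSum (λ r rs′ → R r c * per R rs′ cs) rs
per-column R []       c cs = refl
per-column R (r ∷ rs) c cs = cong (R r c * per R rs cs +_) (begin
  pickSum (λ c′ cs′ → R r c′ * per R rs (c ∷ cs′)) cs
    ≡⟨ pickSum-cong cs (λ {c′} {cs′} _ → ≡.trans (cong (R r c′ *_) (per-column R rs c cs′))
         (pickSum-*ˡ (R r c′) _ rs)) ⟩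
  pickSum (λ c′ cs′ → pickSum (λ r′ rs′ → R r c′ * (R r′ c * per R rs′ cs′)) rs) cs
    ≡⟨ pickSum-comm (λ c′ cs′ r′ rs′ → R r c′ * (R r′ c * per R rs′ cs′)) cs rs ⟩
  pickSum (λ r′ rs′ → pickSum (λ c′ cs′ → R r c′ * (R r′ c * per R rs′ cs′)) cs) rs
    ≡⟨ pickSum-cong rs (λ {r′} {rs′} _ → ≡.trans
         (pickSum-cong cs λ {c′} {cs′} _ → exchange (R r c′) (R r′ c) (per R rs′ cs′))
         (sym (pickSum-*ˡ (R r′ c) _ cs))) ⟩
  pickSum (λ r′ rs′ → R r′ c * per R (r ∷ rs′) cs) rs ∎)
  where
  exchange : ∀ a b c → a * (b * c) ≡ b * (a * c)
  exchange = solve-∀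

per-transpose : ∀ (R : A → B → ℕ) rs cs → per R rs cs ≡ per (flip R) cs rs
per-transpose R []       []       = refl
per-transpose R (r ∷ rs) []       = refl
per-transpose R rs       (c ∷ cs) = ≡.trans (per-column R rs c cs)
  (pickSum-cong rs λ {r} {rs′} _ → cong (R r c *_) (per-transpose R rs′ cs))

per-↭-columns : ∀ (R : A → B → ℕ) rs {cs cs′} → cs ↭ cs′ → per R rs cs ≡ per R rs cs′
per-↭-columns R []       {[]}    {[]}    p = refl
per-↭-columns R []       {[]}    {_ ∷ _} p = ⊥-elim (¬x∷xs↭[] (↭-sym p))
per-↭-columns R []       {_ ∷ _} {[]}    p = ⊥-elim (¬x∷xs↭[] p)
per-↭-columns R []       {_ ∷ _} {_ ∷ _} p = refl
per-↭-columns R (r ∷ rs) p = pickSum-↭ (cong (R r _ *_) ∘ per-↭-columns R rs) p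

per-↭-rows : ∀ (R : A → B → ℕ) {rs rs′} cs → rs ↭ rs′ → per R rs cs ≡ per R rs′ cs
per-↭-rows R cs p = ≡.trans (per-transpose R _ cs)
  (≡.trans (per-↭-columns (flip R) cs p) (sym (per-transpose R _ cs)))

per-map : ∀ (R : A′ → B′ → ℕ) (g : A → A′) (h : B → B′) rs cs →
          per R (map g rs) (map h cs) ≡ per (λ r c → R (g r) (h c)) rs cs
per-map R g h []       []      = refl
per-map R g h []       (_ ∷ _) = refl
per-map R g h (r ∷ rs) cs      = ≡.trans (pickSum-map h _ cs)
  (pickSum-cong cs λ {c} {cs′} _ → cong (R (g r) (h c) *_) (per-map R g h rs cs′))

per-cong : ∀ {R S : A → B → ℕ} → (∀ r c → R r c ≡ S r c) → ∀ rs cs → per R rs cs ≡ per S rs cs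
per-cong eq []       []      = refl
per-cong eq []       (_ ∷ _) = refl
per-cong eq (r ∷ rs) cs      = pickSum-cong cs λ {c} {cs′} _ → cong₂ _*_ (eq r c) (per-cong eq rs cs′)

-- Sweeping a board index by index.

bit : Bool → ℕ
bit b = if b then 1 else 0

pickSum-cong-weights : ∀ {w w′ : A → ℕ} (f : A → List A → ℕ) {xs} → All (λ x → w x ≡ w′ x) xs →
  pickSum (λ x ys → w x * f x ys) xs ≡ pickSum (λ x ys → w′ x * f x ys) xs
pickSum-cong-weights f {xs} eqs = pickSum-cong xs λ {x} {ys} p →
  cong (_* f x ys) (proj₁ (Pick-All p eqs))

per-cong-row : ∀ (R : A → B → ℕ) r r′ rs cs → All (λ c → R r c ≡ R r′ c) cs →
               per R (r ∷ rs) cs ≡ per R (r′ ∷ rs) cs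
per-cong-row R r r′ rs cs = pickSum-cong-weights (λ _ → per R rs)

module Sweep (R : ℕ → ℕ → Bool) where

  -- The board reached after an initial segment of [m] has been processed:
  -- nothing stands for an earlier row (column) whose column (row) is still
  -- to be found among the later indices just k.
  board : Maybe ℕ → Maybe ℕ → ℕ
  board nothing  nothing  = 0
  board nothing  (just y) = 1
  board (just x) nothing  = bit (even x)
  board (just x) (just y) = bit (R x y)

  state : ℕ → List ℕ → List (Maybe ℕ)
  state s l = replicate s nothing ++ map just l

  -- Here `s` rows and `s` columns are carried over. They meet each other in 0, since the partner of
  -- each lies ahead; a carried row admits every later column, and a carried column exactly the even
  -- later rows.
  count : ℕ → List ℕ → ℕ
  count s l = per board (state s l) (state s l)

  -- The outcome when `s + 1` carried rows face `s` carried columns and one further column: that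
  -- column is carried as well, or it goes to one of the `s + 1` rows. The transposed situation
  -- gives the same number.
  split : ℕ → List ℕ → ℕ
  split s l = count (suc s) l + suc s * count s l

  count-front : ∀ s k l →
    count s (k ∷ l) ≡ per board (just k ∷ state s l) (just k ∷ state s l)
  count-front s k l = ≡.trans
    (per-↭-rows board (state s (k ∷ l)) (shift (just k) (replicate s nothing) (map just l)))
    (per-↭-columns board (just k ∷ state s l) (shift (just k) (replicate s nothing) (map just l)))

  weigh-split : ∀ s a b → suc s * (1 * a) + b ≡ suc s * 0 + b + suc s * a
  weigh-split = solve-∀

  -- In the later rows column `k` has the entries of a carried column; in the `s + 1` carried rows
  -- it has 1 where a carried column has 0. Hence the expansions along these two columns differ by
  -- exactly `suc s * count s l`.
  column-split : ∀ s k l → All (λ j → R j k ≡ even j) l →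
    per board (state (suc s) l) (just k ∷ state s l) ≡ split s l
  column-split s k l Rjk = begin
    per board (state (suc s) l) (just k ∷ state s l)
      ≡⟨ per-column board (state (suc s) l) (just k) (state s l) ⟩
    pickSum (λ r rs → board r (just k) * per board rs (state s l)) (state (suc s) l)
      ≡⟨ pickSum-replicate (λ r rs → board r (just k) * per board rs (state s l)) s nothing (map just l) ⟩
    suc s * (1 * count s l)
      + pickSum (λ r rs → board r (just k) * per board (replicate (suc s) nothing ++ rs) (state s l)) (map just l)
      ≡⟨ cong (suc s * (1 * count s l) +_) (pickSum-cong-weights
           {w = λ r → board r (just k)} {λ r → board r nothing}
           (λ _ rs → per board (replicate (suc s) nothing ++ rs) (state s l))
           (All.map⁺ (All.map (cong bit) Rjk))) ⟩
    suc s * (1 * count s l) + later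
      ≡⟨ weigh-split s (count s l) later ⟩
    suc s * 0 + later + suc s * count s l
      ≡⟨ cong (_+ suc s * count s l)
           (pickSum-replicate (λ r rs → board r nothing * per board rs (state s l)) s nothing (map just l)) ⟨
    pickSum (λ r rs → board r nothing * per board rs (state s l)) (state (suc s) l) + suc s * count s l
      ≡⟨ cong (_+ suc s * count s l) (per-column board (state (suc s) l) nothing (state s l)) ⟨
    split s l ∎
    where
    later : ℕ
    later = pickSum (λ r rs → board r nothing * per board (replicate (suc s) nothing ++ rs) (state s l)) (map just l)

  -- The comparison of `column-split` for rows: row `k` agrees with a carried row on the later
  -- columns and, `k` being even, has 1 instead of 0 at the carried columns.
  row-split : ∀ s k l → even k ≡ true → All (λ j → R k j ≡ true) l →
    per board (just k ∷ state s l) (state (suc s) l) ≡ split s l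
  row-split s k l ek Rkj = begin
    pickSum (λ c cs → board (just k) c * per board (state s l) cs) (state (suc s) l)
      ≡⟨ pickSum-replicate (λ c cs → board (just k) c * per board (state s l) cs) s nothing (map just l) ⟩
    suc s * (bit (even k) * count s l)
      + pickSum (λ c cs → board (just k) c * per board (state s l) (replicate (suc s) nothing ++ cs)) (map just l)
      ≡⟨ cong₂ (λ b p → suc s * (bit b * count s l) + p) ek (pickSum-cong-weights
           {w = board (just k)} {board nothing}
           (λ _ cs → per board (state s l) (replicate (suc s) nothing ++ cs))
           (All.map⁺ (All.map (cong bit) Rkj))) ⟩
    suc s * (1 * count s l) + later
      ≡⟨ weigh-split s (count s l) later ⟩
    suc s * 0 + later + suc s * count s l
      ≡⟨ cong (_+ suc s * count s l)
           (pickSum-replicate (λ c cs → board nothing c * per board (state s l) cs) s nothing (map just l)) ⟨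
    split s l ∎
    where
    later : ℕ
    later = pickSum (λ c cs → board nothing c * per board (state s l) (replicate (suc s) nothing ++ cs)) (map just l)

  -- An odd index k takes part in its column only: its row is
  -- indistinguishable from the rows carried over from before k.
  count-odd : ∀ s k l → even k ≡ false → R k k ≡ true →
    All (λ j → R k j ≡ true) l → All (λ j → R j k ≡ even j) l →
    count s (k ∷ l) ≡ split s l
  count-odd s k l ek Rkk Rkj Rjk = begin
    count s (k ∷ l)
      ≡⟨ count-front s k l ⟩
    per board (just k ∷ state s l) (just k ∷ state s l)
      ≡⟨ per-cong-row board (just k) nothing (state s l) (just k ∷ state s l)
           (cong bit Rkk ∷ All.++⁺ (All.replicate⁺ s (cong bit ek)) (All.map⁺ (All.map (cong bit) Rkj))) ⟩
    per board (state (suc s) l) (just k ∷ state s l)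
      ≡⟨ column-split s k l Rjk ⟩
    split s l ∎

  -- Unfolding `split` gives `s + 1` times `count s l` plus s² times `count` at `s - 1`; the case
  -- `zero` stands apart because it has no `s - 1`.
  evenStep : ℕ → List ℕ → ℕ
  evenStep zero    l = count zero l
  evenStep (suc s) l = count (suc s) l + suc s * split s l

  weigh-even : ∀ a s b → 1 * a + (suc s * (1 * b) + 0) ≡ a + suc s * b
  weigh-even = solve-∀

  weigh-even₀ : ∀ a → 1 * a + 0 ≡ a
  weigh-even₀ = solve-∀

  -- Row `k` vanishes on the later columns, so it takes its own column or one of the `s` carried
  -- ones. In the second case column `k` still waits beside one carried column fewer, which is the
  -- situation of `column-split`.
  count-even-row : ∀ s k l → even k ≡ true → R k k ≡ true →
    All (λ j → R k j ≡ false) l → All (λ j → R j k ≡ even j) l →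
    count s (k ∷ l) ≡ evenStep s l
  count-even-row s k l ek Rkk Rkj Rjk = ≡.trans (count-front s k l) (expand s)
    where
    vanish : ∀ f → pickSum (λ c cs → board (just k) c * f c cs) (map just l) ≡ 0
    vanish f = ≡.trans
      (pickSum-cong-weights {w = board (just k)} {λ _ → 0} f (All.map⁺ (All.map (cong bit) Rkj)))
      (pickSum-zero (map just l))

    expand : ∀ s → per board (just k ∷ state s l) (just k ∷ state s l) ≡ evenStep s l
    expand zero = ≡.trans
      (cong₂ (λ b p → bit b * count 0 l + p) Rkk (vanish λ c cs → per board (state 0 l) (just k ∷ cs)))
      (weigh-even₀ (count 0 l))
    expand (suc s) = begin
      bit (R k k) * count (suc s) l
        + pickSum (λ c cs → board (just k) c * per board (state (suc s) l) (just k ∷ cs)) (state (suc s) l)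
        ≡⟨ cong₂ (λ b p → bit b * count (suc s) l + p) Rkk
             (pickSum-replicate (λ c cs → board (just k) c * per board (state (suc s) l) (just k ∷ cs))
                                s nothing (map just l)) ⟩
      1 * count (suc s) l + (suc s * (bit (even k) * per board (state (suc s) l) (just k ∷ state s l))
        + pickSum (λ c cs → board (just k) c
            * per board (state (suc s) l) (just k ∷ replicate (suc s) nothing ++ cs)) (map just l))
        ≡⟨ cong (1 * count (suc s) l +_) (cong₂ _+_
             (cong₂ (λ b p → suc s * (bit b * p)) ek (column-split s k l Rjk))
             (vanish λ c cs → per board (state (suc s) l) (just k ∷ replicate (suc s) nothing ++ cs))) ⟩
      1 * count (suc s) l + (suc s * (1 * split s l) + 0)
        ≡⟨ weigh-even (count (suc s) l) s (split s l) ⟩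
      evenStep (suc s) l ∎

  -- Here column `k` vanishes on the later rows: it goes to row `k` or to one of the `s` carried
  -- rows, and in the second case row `k` still has to be placed, by `row-split`.
  count-even-column : ∀ s k l → even k ≡ true → R k k ≡ true →
    All (λ j → R k j ≡ true) l → All (λ j → R j k ≡ false) l →
    count s (k ∷ l) ≡ evenStep s l
  count-even-column s k l ek Rkk Rkj Rjk = ≡.trans (count-front s k l)
    (≡.trans (per-column board (just k ∷ state s l) (just k) (state s l)) (expand s))
    where
    vanish : ∀ f → pickSum (λ r rs → board r (just k) * f r rs) (map just l) ≡ 0
    vanish f = ≡.trans
      (pickSum-cong-weights {w = λ r → board r (just k)} {λ _ → 0} f (All.map⁺ (All.map (cong bit) Rjk)))
      (pickSum-zero (map just l))

    expand : ∀ s → pickSum (λ r rs → board r (just k) * per board rs (state s l)) (just k ∷ state s l)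
                   ≡ evenStep s l
    expand zero = ≡.trans
      (cong₂ (λ b p → bit b * count 0 l + p) Rkk (vanish λ r rs → per board (just k ∷ rs) (state 0 l)))
      (weigh-even₀ (count 0 l))
    expand (suc s) = begin
      bit (R k k) * count (suc s) l
        + pickSum (λ r rs → board r (just k) * per board (just k ∷ rs) (state (suc s) l)) (state (suc s) l)
        ≡⟨ cong₂ (λ b p → bit b * count (suc s) l + p) Rkk
             (pickSum-replicate (λ r rs → board r (just k) * per board (just k ∷ rs) (state (suc s) l))
                                s nothing (map just l)) ⟩
      1 * count (suc s) l + (suc s * (1 * per board (just k ∷ state s l) (state (suc s) l))
        + pickSum (λ r rs → board r (just k)
            * per board (just k ∷ replicate (suc s) nothing ++ rs) (state (suc s) l)) (map just l))
        ≡⟨ cong (1 * count (suc s) l +_) (cong₂ _+_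
             (cong (λ p → suc s * (1 * p)) (row-split s k l ek Rkj))
             (vanish λ r rs → per board (just k ∷ replicate (suc s) nothing ++ rs) (state (suc s) l))) ⟩
      1 * count (suc s) l + (suc s * (1 * split s l) + 0)
        ≡⟨ weigh-even (count (suc s) l) s (split s l) ⟩
      evenStep (suc s) l ∎

-- The boards of the two problems and their comparison.

<⇒<ᵇ≡true : ∀ {m n} → m < n → (m <ᵇ n) ≡ true
<⇒<ᵇ≡true {m} {n} m<n with m <ᵇ n | <⇒<ᵇ m<n
... | true | _ = refl

≤⇒<ᵇ≡false : ∀ {m n} → n ≤ m → (m <ᵇ n) ≡ false
≤⇒<ᵇ≡false {m} {n} n≤m with m <ᵇ n in eq
... | false = refl
... | true  = ⊥-elim (≤⇒≯ n≤m (<ᵇ⇒< m n (subst T (sym eq) _)))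

range : ℕ → ℕ → List ℕ
range k zero    = []
range k (suc m) = k ∷ range (suc k) m

range-≥ : ∀ {a} k m → a ≤ k → All (a ≤_) (range k m)
range-≥ k zero    a≤k = []
range-≥ k (suc m) a≤k = a≤k ∷ range-≥ (suc k) m (m≤n⇒m≤1+n a≤k)

range-sorted : ∀ k m → AllPairs _<_ (range k m)
range-sorted k zero    = []
range-sorted k (suc m) = range-≥ (suc k) m ≤-refl ∷ range-sorted (suc k) m

map-suc-range : ∀ k m → map suc (range k m) ≡ range (suc k) m
map-suc-range k zero    = refl
map-suc-range k (suc m) = cong (suc k ∷_) (map-suc-range (suc k) m)

range-∷ʳ : ∀ k m → range k (suc m) ≡ range k m ++ (k + m) ∷ []
range-∷ʳ k zero    = cong (_∷ []) (sym (+-identityʳ k))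
range-∷ʳ k (suc m) = cong (k ∷_) (≡.trans (range-∷ʳ (suc k) m)
  (cong (λ z → range (suc k) m ++ z ∷ []) (sym (+-suc k m))))

-- mayFollow 0 y always holds, so that 0 can serve as the start of a word.
mayFollow : ℕ → ℕ → Bool
mayFollow x y = if y <ᵇ x then even x ∧ odd y else true

-- Rows are positions and columns are values. `strict` is the Dumont condition; `weak` also allows
-- fixed points, `y <ᵇ suc x` being `y ≤ x`.
strict weak : ℕ → ℕ → Bool
strict x y = if even x then y <ᵇ x else x <ᵇ y
weak   x y = if even x then y <ᵇ suc x else x <ᵇ suc y

module E = Sweep mayFollow
module D = Sweep weak

mayFollow-≤ : ∀ {x y} → x ≤ y → mayFollow x y ≡ true
mayFollow-≤ {x} {y} x≤y rewrite ≤⇒<ᵇ≡false x≤y = refl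

mayFollow-odd : ∀ {k j} → even k ≡ false → k < j → mayFollow j k ≡ even j
mayFollow-odd {k} {j} ek k<j rewrite <⇒<ᵇ≡true k<j | ek = ∧-identityʳ (even j)

mayFollow-even : ∀ {k j} → even k ≡ true → k < j → mayFollow j k ≡ false
mayFollow-even {k} {j} ek k<j rewrite <⇒<ᵇ≡true k<j | ek = ∧-zeroʳ (even j)

weak-diagonal : ∀ k → weak k k ≡ true
weak-diagonal k with even k
... | true  = <⇒<ᵇ≡true (n<1+n k)
... | false = <⇒<ᵇ≡true (n<1+n k)

weak-column : ∀ {k j} → k < j → weak j k ≡ even j
weak-column {k} {j} k<j with even j
... | true  = <⇒<ᵇ≡true (m<n⇒m<1+n k<j)
... | false = ≤⇒<ᵇ≡false k<j

weak-odd : ∀ {k j} → even k ≡ false → k < j → weak k j ≡ true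
weak-odd ek k<j rewrite ek = <⇒<ᵇ≡true (m<n⇒m<1+n k<j)

weak-even : ∀ {k j} → even k ≡ true → k < j → weak k j ≡ false
weak-even ek k<j rewrite ek = ≤⇒<ᵇ≡false k<j

range-All : ∀ {P : ℕ → Set} {k} m → (∀ {j} → k < j → P j) → All P (range (suc k) m)
range-All m imp = All.map imp (range-≥ _ m ≤-refl)

-- Odd indices obey the same rule on both boards. An even index settles its column for `mayFollow`
-- and its row for `weak`, yet both give `evenStep`. The induction takes indices in pairs, with `s`
-- free because each step involves neighbouring values of it.
count-≡ : ∀ m k s → even k ≡ false → even (suc k) ≡ true →
          E.count s (range k (m * 2)) ≡ D.count s (range k (m * 2))
count-≡ zero    k s _  _   = per-empty s
  where
  per-empty : ∀ s → E.count s [] ≡ D.count s []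
  per-empty zero    = refl
  -- With no index left, a carried row meets only carried columns, and all these entries are 0.
  per-empty (suc s) = ≡.trans (vanish mayFollow) (sym (vanish weak))
    where
    vanish : ∀ R → Sweep.count R (suc s) [] ≡ 0
    vanish R = ≡.trans (pickSum-cong-weights {w = Sweep.board R nothing} {λ _ → 0}
        (λ _ → per (Sweep.board R) (Sweep.state R s [])) (All.++⁺ (All.replicate⁺ (suc s) refl) []))
      (pickSum-zero (Sweep.state R (suc s) []))
count-≡ (suc m) k s ek ek′ = begin
  E.count s (k ∷ suc k ∷ l)
    ≡⟨ E.count-odd s k (suc k ∷ l) ek (mayFollow-≤ {k} ≤-refl)
         (range-All (suc (m * 2)) (mayFollow-≤ ∘ <⇒≤)) (range-All (suc (m * 2)) (mayFollow-odd ek)) ⟩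
  E.split s (suc k ∷ l)
    ≡⟨ cong₂ (λ a b → a + suc s * b) (even-≡ (suc s)) (even-≡ s) ⟩
  D.split s (suc k ∷ l)
    ≡⟨ D.count-odd s k (suc k ∷ l) ek (weak-diagonal k)
         (range-All (suc (m * 2)) (weak-odd ek)) (range-All (suc (m * 2)) weak-column) ⟨
  D.count s (k ∷ suc k ∷ l) ∎
  where
  l : List ℕ
  l = range (suc (suc k)) (m * 2)

  IH : ∀ s → E.count s l ≡ D.count s l
  -- `even` has period 2 by computation, so the parity proofs for `k` and `suc k` serve again.
  IH s = count-≡ m (suc (suc k)) s ek ek′

  evenStep-≡ : ∀ s → E.evenStep s l ≡ D.evenStep s l
  evenStep-≡ zero    = IH 0
  evenStep-≡ (suc s) = cong₂ (λ a b → a + suc s * (a + suc s * b)) (IH (suc s)) (IH s)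

  even-≡ : ∀ s → E.count s (suc k ∷ l) ≡ D.count s (suc k ∷ l)
  even-≡ s = begin
    E.count s (suc k ∷ l)
      ≡⟨ E.count-even-column s (suc k) l ek′ (mayFollow-≤ {suc k} ≤-refl)
           (range-All (m * 2) (mayFollow-≤ ∘ <⇒≤)) (range-All (m * 2) (mayFollow-even ek′)) ⟩
    E.evenStep s l
      ≡⟨ evenStep-≡ s ⟩
    D.evenStep s l
      ≡⟨ D.count-even-row s (suc k) l ek′ (weak-diagonal (suc k))
           (range-All (m * 2) (weak-even ek′)) (range-All (m * 2) weak-column) ⟨
    D.count s (suc k ∷ l) ∎

matrix : (ℕ → ℕ → Bool) → ℕ → ℕ → ℕ
matrix R x y = bit (R x y)

per-mayFollow≡per-weak : ∀ m →
  per (matrix mayFollow) (range 1 (m * 2)) (range 1 (m * 2)) ≡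
  per (matrix weak) (range 1 (m * 2)) (range 1 (m * 2))
per-mayFollow≡per-weak m = begin
  per (matrix mayFollow) l l ≡⟨ per-map E.board just just l l ⟨
  E.count 0 l                ≡⟨ count-≡ m 1 0 refl refl ⟩
  D.count 0 l                ≡⟨ per-map D.board just just l l ⟩
  per (matrix weak) l l      ∎
  where
  l = range 1 (m * 2)

-- Foata's transformation between words and cycles.

words : ℕ → ℕ → List ℕ → ℕ
words a zero    l = 1
words a (suc n) l = pickSum (λ b l′ → matrix mayFollow a b * words b n l′) l

words-cong : ∀ x y n l → All (λ z → mayFollow x z ≡ mayFollow y z) l →
             words x n l ≡ words y n l
words-cong x y zero    l eq = refl
words-cong x y (suc n) l eq = pickSum-cong-weights {w = matrix mayFollow x} {matrix mayFollow y}
  (λ b → words b n) (All.map (cong bit) eq)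

-- Foata's transformation, with x playing the role of the minimum of the
-- cycle under construction: a path from a that reaches x closes this cycle
-- on the left and is continued by an arbitrary word on the right.
per-cycle≡words : ∀ n a x l → length l ≡ n → All (x <_) l → AllPairs _<_ l →
                  per (matrix mayFollow) (a ∷ l) (x ∷ l) ≡ words a (suc n) (x ∷ l)
per-cycle≡words n a x l len x<l sorted = cong₂ _+_
  (cong (matrix mayFollow a x *_) (close n l len x<l sorted))
  (pickSum-cong l λ {b} {l′} p → cong (matrix mayFollow a b *_) (continue n len p))
  where
  close : ∀ n l → length l ≡ n → All (x <_) l → AllPairs _<_ l →
          per (matrix mayFollow) l l ≡ words x n l
  close zero    []       len x<l         _                = refl
  -- The next cycle opens at the least remaining letter `y`. Neither `x` nor `y` exceeds any
  -- remaining letter, so each of these may follow both, and the word may go on from `x` instead of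
  -- `y`.
  close (suc n) (y ∷ l) len (x<y ∷ x<l) (y<l ∷ sorted) = ≡.trans
    (per-cycle≡words n y y l (suc-injective len) y<l sorted)
    (words-cong y x (suc n) (y ∷ l) (≡.trans (mayFollow-≤ {y} ≤-refl) (sym (mayFollow-≤ (<⇒≤ x<y)))
      ∷ All.zipWith (λ (y<z , x<z) → ≡.trans (mayFollow-≤ (<⇒≤ y<z)) (sym (mayFollow-≤ (<⇒≤ x<z))))
          (y<l , x<l)))

  continue : ∀ n {b l′} → length l ≡ n → Pick b l′ l →
             per (matrix mayFollow) l (x ∷ l′) ≡ words b n (x ∷ l′)
  continue zero    len p with () ← ≡.trans (sym len) (Pick-length p)
  continue (suc n) {b} {l′} len p = ≡.trans
    (per-↭-rows (matrix mayFollow) (x ∷ l′) (Pick-↭ p))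
    (per-cycle≡words n b x l′ (suc-injective (≡.trans (sym (Pick-length p)) len))
      (proj₂ (Pick-All p x<l)) (Pick-AllPairs p sorted))

length-range : ∀ k m → length (range k m) ≡ m
length-range k zero    = refl
length-range k (suc m) = cong suc (length-range (suc k) m)

-- The first cycle opens at 1, and since no letter is below 1, starting from 1 is no more
-- restrictive than starting from 0.
per-range≡words : ∀ m → per (matrix mayFollow) (range 1 m) (range 1 m) ≡ words 0 m (range 1 m)
per-range≡words zero    = refl
per-range≡words (suc m) = ≡.trans
  (per-cycle≡words m 1 1 (range 2 m) (length-range 2 m) (range-≥ 2 m ≤-refl) (range-sorted 2 m))
  (words-cong 1 0 (suc m) (range 1 (suc m)) (All.map (λ {y} → first {y}) (range-≥ 1 (suc m) ≤-refl)))
  where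
  first : ∀ {y} → 1 ≤ y → mayFollow 1 y ≡ mayFollow 0 y
  first {suc y} _ = refl

-- Removing the forced positions of a Dumont derangement.

-- Rows are relabelled by `spread` and columns by `suc`; the image of 1, ..., 2m under `spread`
-- lacks just 2 and 2m + 1 among 1, ..., 2m + 2.
spread : ℕ → ℕ
spread x = if even x then suc (suc x) else x

-- `suc k` and `k` change places, and the image `3 + k` of `suc k` becomes the extra head for the
-- induction at `2 + k`.
spread-range : ∀ m k → even k ≡ false → even (suc k) ≡ true →
  suc k ∷ map spread (range k (m * 2)) ++ (k + m * 2) ∷ [] ↭ range k (suc (suc (m * 2)))
spread-range zero    k ek ek′ rewrite +-identityʳ k = swap (suc k) k refl
spread-range (suc m) k ek ek′ rewrite ek | ek′ = trans
  (swap (suc k) k refl)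
  (prep k (prep (suc k) (subst
    (λ z → 3 + k ∷ map spread (range (2 + k) (m * 2)) ++ z ∷ [] ↭ range (2 + k) (2 + m * 2))
    (sym (≡.trans (+-suc k (suc (m * 2))) (cong suc (+-suc k (m * 2)))))
    (spread-range m (2 + k) ek ek′))))

range-< : ∀ k m → All (_< k + m) (range k m)
range-< k zero    = []
range-< k (suc m) rewrite +-suc k m = s≤s (m≤m+n k m) ∷ range-< (suc k) m

per-corner : ∀ (R : A → B → ℕ) r rs c cs → R r c ≡ 1 → All (λ c′ → R r c′ ≡ 0) cs →
             per R (r ∷ rs) (c ∷ cs) ≡ per R rs cs
per-corner R r rs c cs one zeros = begin
  R r c * per R rs cs + pickSum (λ c′ cs′ → R r c′ * per R rs (c ∷ cs′)) cs
    ≡⟨ cong₂ (λ w p → w * per R rs cs + p) one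
         (pickSum-cong-weights {w = R r} {λ _ → 0} (λ _ cs′ → per R rs (c ∷ cs′)) zeros) ⟩
  1 * per R rs cs + pickSum (λ _ _ → 0) cs
    ≡⟨ cong₂ _+_ (*-identityˡ (per R rs cs)) (pickSum-zero cs) ⟩
  per R rs cs + 0
    ≡⟨ +-identityʳ (per R rs cs) ⟩
  per R rs cs ∎

strict-spread : ∀ x y → strict (spread x) (suc y) ≡ weak x y
strict-spread x y with even x in eq
... | true  rewrite eq = refl
... | false rewrite eq = refl

even-double : ∀ m → even (m * 2) ≡ true
even-double zero    = refl
even-double (suc m) = even-double m

odd-suc-double : ∀ m → even (suc (m * 2)) ≡ false
odd-suc-double zero    = refl
odd-suc-double (suc m) = odd-suc-double m

-- In row 2 of the strict board only column 1 is admissible, and in row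
-- 2m + 1 only column 2m + 2.
per-strict≡per-weak : ∀ m →
  per (matrix strict) (range 1 (2 + m * 2)) (range 1 (2 + m * 2)) ≡
  per (matrix weak) (range 1 (m * 2)) (range 1 (m * 2))
per-strict≡per-weak m = begin
  per S (range 1 (2 + m * 2)) (range 1 (2 + m * 2))
    ≡⟨ per-↭-rows S (range 1 (2 + m * 2)) rows ⟩
  per S (2 ∷ last ∷ map spread l) (range 1 (2 + m * 2))
    ≡⟨ per-corner S 2 (last ∷ map spread l) 1 (range 2 (suc (m * 2))) refl
         (All.map (λ 2≤y → cong bit (≤⇒<ᵇ≡false 2≤y)) (range-≥ 2 (suc (m * 2)) ≤-refl)) ⟩
  per S (last ∷ map spread l) (range 2 (suc (m * 2)))
    ≡⟨ per-↭-columns S (last ∷ map spread l) columns ⟩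
  per S (last ∷ map spread l) (suc last ∷ map suc l)
    ≡⟨ per-corner S last (map spread l) (suc last) (map suc l)
         (cong bit (odd-row (suc last) (<⇒<ᵇ≡true (n<1+n last))))
         (All.map⁺ (All.map (λ {y} y<last → cong bit (odd-row (suc y) (≤⇒<ᵇ≡false y<last))) (range-< 1 (m * 2)))) ⟩
  per S (map spread l) (map suc l)
    ≡⟨ per-map S spread suc l l ⟩
  per (λ x y → S (spread x) (suc y)) l l
    ≡⟨ per-cong (λ x y → cong bit (strict-spread x y)) l l ⟩
  per (matrix weak) l l ∎
  where
  S = matrix strict
  l = range 1 (m * 2)
  last = suc (m * 2)

  rows : range 1 (2 + m * 2) ↭ 2 ∷ last ∷ map spread l
  rows = trans (↭-sym (spread-range m 1 refl refl))
    (prep 2 (subst (λ zs → map spread l ++ last ∷ [] ↭ last ∷ zs) (++-identityʳ (map spread l))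
      (shift last (map spread l) [])))

  columns : range 2 (suc (m * 2)) ↭ suc last ∷ map suc l
  columns = subst (_↭ suc last ∷ map suc l)
    (sym (≡.trans (range-∷ʳ 2 (m * 2)) (cong (_++ suc last ∷ []) (sym (map-suc-range 1 (m * 2))))))
    (subst (λ zs → map suc l ++ suc last ∷ [] ↭ suc last ∷ zs) (++-identityʳ (map suc l))
      (shift (suc last) (map suc l) []))

  odd-row : ∀ y {b} → (last <ᵇ y) ≡ b → strict last y ≡ b
  odd-row y eq rewrite odd-suc-double m = eq

-- Counting vectors and permutations by sums.

sumOver : List A → (A → ℕ) → ℕ
sumOver xs f = sum (map f xs)

sumOver-cong : ∀ {f g : A → ℕ} xs → (∀ x → f x ≡ g x) → sumOver xs f ≡ sumOver xs g
sumOver-cong xs eq = cong sum (map-cong eq xs)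

sumOver-*ˡ : ∀ k (f : A → ℕ) xs → sumOver xs (λ x → k * f x) ≡ k * sumOver xs f
sumOver-*ˡ k f []       = sym (*-zeroʳ k)
sumOver-*ˡ k f (x ∷ xs) = ≡.trans (cong (k * f x +_) (sumOver-*ˡ k f xs))
  (sym (*-distribˡ-+ k (f x) (sumOver xs f)))

sumOver≡pickSum : ∀ (f : A → ℕ) xs → sumOver xs f ≡ pickSum (λ x _ → f x) xs
sumOver≡pickSum f []       = refl
sumOver≡pickSum f (x ∷ xs) = cong (f x +_) (sumOver≡pickSum f xs)

sumVec : ∀ n → List A → (Vec A n → ℕ) → ℕ
sumVec zero    xs f = f []
sumVec (suc n) xs f = sumOver xs (λ x → sumVec n xs (f ∘ (x ∷_)))

sumVec-cong : ∀ n (xs : List A) {f g} → (∀ v → f v ≡ g v) → sumVec n xs f ≡ sumVec n xs g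
sumVec-cong zero    xs eq = eq []
sumVec-cong (suc n) xs eq = sumOver-cong xs λ x → sumVec-cong n xs (eq ∘ (x ∷_))

sumVec-*ˡ : ∀ n (xs : List A) k f → sumVec n xs (λ v → k * f v) ≡ k * sumVec n xs f
sumVec-*ˡ zero    xs k f = refl
sumVec-*ˡ (suc n) xs k f = ≡.trans
  (sumOver-cong xs λ x → sumVec-*ˡ n xs k (f ∘ (x ∷_)))
  (sumOver-*ˡ k (λ x → sumVec n xs (f ∘ (x ∷_))) xs)

T↔Fin : ∀ b → T b ↔ Fin (bit b)
T↔Fin true  = ↔-sym 1↔⊤
T↔Fin false = ↔-sym 0↔⊥

ΣFin-suc : (P : Fin (suc m) → Set) → Σ (Fin (suc m)) P ↔ (P zero ⊎ Σ (Fin m) (P ∘ suc))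
ΣFin-suc P = mk↔ₛ′
  (λ { (zero , p) → inj₁ p ; (suc i , p) → inj₂ (i , p) })
  (λ { (inj₁ p) → zero , p ; (inj₂ (i , p)) → suc i , p })
  (λ { (inj₁ _) → refl ; (inj₂ _) → refl })
  (λ { (zero , _) → refl ; (suc _ , _) → refl })

ΣFin↔Fin-sum : ∀ {P : Fin m → Set} (f : Fin m → ℕ) → (∀ i → P i ↔ Fin (f i)) →
               Σ (Fin m) P ↔ Fin (sum (tabulate f))
ΣFin↔Fin-sum {zero}  f e = mk↔ₛ′ (λ ()) (λ ()) (λ ()) (λ ())
ΣFin↔Fin-sum {suc m} {P} f e = ↔-trans (ΣFin-suc P)
  (↔-trans (e zero ⊎-↔ ΣFin↔Fin-sum (f ∘ suc) (e ∘ suc)) (↔-sym +↔⊎))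

ΣVec-∷ : (P : Vec A (suc n) → Set) → Σ (Vec A (suc n)) P ↔ Σ A (λ x → Σ (Vec A n) (P ∘ (x ∷_)))
ΣVec-∷ P = mk↔ₛ′
  (λ { (x ∷ v , p) → x , v , p }) (λ { (x , v , p) → x ∷ v , p }) (λ _ → refl) (λ { (_ ∷ _ , _) → refl })

ΣVec↔Fin : ∀ n (p : Vec (Fin m) n → Bool) →
           Σ (Vec (Fin m) n) (T ∘ p) ↔ Fin (sumVec n (allFin m) (bit ∘ p))
ΣVec↔Fin zero p = ↔-trans
  (mk↔ₛ′ (λ { ([] , t) → t }) (λ t → [] , t) (λ _ → refl) (λ { ([] , _) → refl })) (T↔Fin (p []))
ΣVec↔Fin {m} (suc n) p = ↔-trans (ΣVec-∷ (T ∘ p))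
  (subst (λ k → Σ (Fin m) (λ x → Σ (Vec (Fin m) n) (T ∘ p ∘ (x ∷_))) ↔ Fin k) (cong sum (sym (map-tabulate id s)))
    (ΣFin↔Fin-sum s λ x → ΣVec↔Fin n (p ∘ (x ∷_))))
  where
  s : Fin m → ℕ
  s x = sumVec n (allFin m) (bit ∘ p ∘ (x ∷_))

arrangementSum : ∀ n → List A → (Vec A n → ℕ) → ℕ
arrangementSum zero    xs f = f []
arrangementSum (suc n) xs f = pickSum (λ x ys → arrangementSum n ys (f ∘ (x ∷_))) xs

arrangementSum-cong : ∀ n (xs : List A) {f g} → (∀ v → f v ≡ g v) →
                      arrangementSum n xs f ≡ arrangementSum n xs g
arrangementSum-cong zero    xs eq = eq []
arrangementSum-cong (suc n) xs eq =
  pickSum-cong xs λ {x} {ys} _ → arrangementSum-cong n ys (eq ∘ (x ∷_))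

arrangementSum-*ˡ : ∀ n (xs : List A) k f →
                    arrangementSum n xs (λ v → k * f v) ≡ k * arrangementSum n xs f
arrangementSum-*ˡ zero    xs k f = refl
arrangementSum-*ˡ (suc n) xs k f = ≡.trans
  (pickSum-cong xs λ {x} {ys} _ → arrangementSum-*ˡ n ys k (f ∘ (x ∷_)))
  (sym (pickSum-*ˡ k _ xs))

bit-∧ : ∀ a b → bit (a ∧ b) ≡ bit a * bit b
bit-∧ true  b = sym (+-identityʳ (bit b))
bit-∧ false b = refl

differs : Fin m → Fin m → Bool
differs x y = not ⌊ x ≟ y ⌋

differs-≢ : ∀ {x y : Fin m} → x ≢ y → differs x y ≡ true
differs-≢ {x = x} {y} x≢y with x ≟ y
... | yes x≡y = ⊥-elim (x≢y x≡y)
... | no _    = refl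

differs-refl : ∀ (x : Fin m) → differs x x ≡ false
differs-refl x with x ≟ x
... | yes _   = refl
... | no x≢x = ⊥-elim (x≢x refl)

sumOver-differs : ∀ {x : Fin m} {xs ys} (f : Fin m → ℕ) → Pick x ys xs → Unique xs →
                  sumOver xs (λ y → bit (differs x y) * f y) ≡ sumOver ys f
sumOver-differs {x = x} f (here {xs}) (x∉xs ∷ _) = begin
  bit (differs x x) * f x + sumOver xs (λ y → bit (differs x y) * f y)
    ≡⟨ cong (λ b → bit b * f x + sumOver xs (λ y → bit (differs x y) * f y)) (differs-refl x) ⟩
  sumOver xs (λ y → bit (differs x y) * f y)
    ≡⟨ others xs x∉xs ⟩
  sumOver xs f ∎
  where
  others : ∀ ys → All (x ≢_) ys → sumOver ys (λ y → bit (differs x y) * f y) ≡ sumOver ys f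
  others []       []            = refl
  others (y ∷ ys) (x≢y ∷ x∉ys) = cong₂ _+_
    (≡.trans (cong (λ b → bit b * f y) (differs-≢ x≢y)) (*-identityˡ (f y)))
    (others ys x∉ys)
sumOver-differs {x = x} f (there {y = y} p) (y∉xs ∷ uniq) = cong₂ _+_
  (≡.trans (cong (λ b → bit b * f y) (differs-≢ (proj₁ (Pick-All p y∉xs) ∘ sym))) (*-identityˡ (f y)))
  (sumOver-differs f p uniq)

-- The factor splits over the letters, and at each letter it removes exactly `x` from an alphabet
-- without repetitions.
sumVec-differs : ∀ n {x : Fin m} {xs ys} (f : Vec (Fin m) n → ℕ) → Pick x ys xs → Unique xs →
                 sumVec n xs (λ v → bit (allB (differs x) v) * f v) ≡ sumVec n ys f
sumVec-differs zero    f p uniq = +-identityʳ (f [])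
sumVec-differs (suc n) {x} {xs} {ys} f p uniq = begin
  sumOver xs (λ y → sumVec n xs (λ v → bit (differs x y ∧ allB (differs x) v) * f (y ∷ v)))
    ≡⟨ sumOver-cong xs (λ y → ≡.trans
         (sumVec-cong n xs λ v → ≡.trans
           (cong (_* f (y ∷ v)) (bit-∧ (differs x y) (allB (differs x) v)))
           (*-assoc (bit (differs x y)) _ (f (y ∷ v))))
         (sumVec-*ˡ n xs (bit (differs x y)) _)) ⟩
  sumOver xs (λ y → bit (differs x y) * sumVec n xs (λ v → bit (allB (differs x) v) * f (y ∷ v)))
    ≡⟨ sumOver-cong xs (λ y → cong (bit (differs x y) *_) (sumVec-differs n (f ∘ (y ∷_)) p uniq)) ⟩
  sumOver xs (λ y → bit (differs x y) * sumVec n ys (f ∘ (y ∷_)))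
    ≡⟨ sumOver-differs (λ y → sumVec n ys (f ∘ (y ∷_))) p uniq ⟩
  sumVec (suc n) ys f ∎

-- After the first letter `x`, distinctness asks that the other letters avoid `x`, which shrinks the
-- alphabet, and that they be distinct among themselves, which is the induction.
sumVec-distinct : ∀ n (xs : List (Fin m)) (f : Vec (Fin m) n → ℕ) → Unique xs →
                  sumVec n xs (λ v → bit (distinct v) * f v) ≡ arrangementSum n xs f
sumVec-distinct zero    xs f uniq = +-identityʳ (f [])
sumVec-distinct (suc n) xs f uniq = ≡.trans (sumOver≡pickSum _ xs)
  (pickSum-cong xs λ {x} {ys} p → begin
    sumVec n xs (λ v → bit (allB (differs x) v ∧ distinct v) * f (x ∷ v))
      ≡⟨ sumVec-cong n xs (λ v → ≡.trans
           (cong (_* f (x ∷ v)) (bit-∧ (allB (differs x) v) (distinct v)))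
           (*-assoc (bit (allB (differs x) v)) _ (f (x ∷ v)))) ⟩
    sumVec n xs (λ v → bit (allB (differs x) v) * (bit (distinct v) * f (x ∷ v)))
      ≡⟨ sumVec-differs n (λ v → bit (distinct v) * f (x ∷ v)) p uniq ⟩
    sumVec n ys (λ v → bit (distinct v) * f (x ∷ v))
      ≡⟨ sumVec-distinct n ys (f ∘ (x ∷_)) (Pick-AllPairs p uniq) ⟩
    arrangementSum n ys (f ∘ (x ∷_)) ∎)

-- With both sets of permutations in this form, the required bijection reduces to an equality of two
-- numbers.
PermsWith↔Fin : ∀ m (P : Vec (Fin m) m → Bool) →
                PermsWith m P ↔ Fin (arrangementSum m (allFin m) (bit ∘ P))
PermsWith↔Fin m P = subst (λ k → PermsWith m P ↔ Fin k)
  (≡.trans (sumVec-cong m (allFin m) λ v → bit-∧ (distinct v) (P v))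
           (sumVec-distinct m (allFin m) (bit ∘ P) (allFin⁺ m)))
  (ΣVec↔Fin m (λ v → isPerm v ∧ P v))

-- From the conditions on permutations to permanents and words.

value : Fin m → ℕ
value = suc ∘ toℕ

map-value-allFin : ∀ m → map value (allFin m) ≡ range 1 m
map-value-allFin m = ≡.trans (map-tabulate id value) (values m 1 value λ _ → refl)
  where
  values : ∀ m k (f : Fin m → ℕ) → (∀ i → f i ≡ k + toℕ i) → tabulate f ≡ range k m
  values zero    k f eq = refl
  values (suc m) k f eq = cong₂ _∷_ (≡.trans (eq zero) (+-identityʳ k))
    (values m (suc k) (f ∘ suc) λ i → ≡.trans (eq (suc i)) (+-suc k (toℕ i)))

dumont : ℕ → Vec (Fin m) n → Bool
dumont k []      = true
dumont k (x ∷ v) = strict k (value x) ∧ dumont (suc k) v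

arrangementSum-dumont : ∀ n k (xs : List (Fin m)) → length xs ≡ n →
  arrangementSum n xs (bit ∘ dumont k) ≡ per (λ r x → matrix strict r (value x)) (range k n) xs
arrangementSum-dumont zero    k []       len = refl
arrangementSum-dumont (suc n) k xs       len = pickSum-cong xs λ {x} {ys} p → begin
  arrangementSum n ys (λ v → bit (strict k (value x) ∧ dumont (suc k) v))
    ≡⟨ arrangementSum-cong n ys (λ v → bit-∧ (strict k (value x)) (dumont (suc k) v)) ⟩
  arrangementSum n ys (λ v → bit (strict k (value x)) * bit (dumont (suc k) v))
    ≡⟨ arrangementSum-*ˡ n ys (bit (strict k (value x))) (bit ∘ dumont (suc k)) ⟩
  bit (strict k (value x)) * arrangementSum n ys (bit ∘ dumont (suc k))
    ≡⟨ cong (bit (strict k (value x)) *_) (arrangementSum-dumont n (suc k) ys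
         (suc-injective (≡.trans (sym (Pick-length p)) len))) ⟩
  bit (strict k (value x)) * per (λ r x → matrix strict r (value x)) (range (suc k) n) ys ∎

chain : ℕ → Vec (Fin m) n → Bool
chain a []      = true
chain a (x ∷ v) = mayFollow a (value x) ∧ chain (value x) v

arrangementSum-chain : ∀ n a (xs : List (Fin m)) →
  arrangementSum n xs (bit ∘ chain a) ≡ words a n (map value xs)
arrangementSum-chain zero    a xs = refl
arrangementSum-chain (suc n) a xs = ≡.trans
  (pickSum-cong xs λ {x} {ys} _ → begin
    arrangementSum n ys (λ v → bit (mayFollow a (value x) ∧ chain (value x) v))
      ≡⟨ arrangementSum-cong n ys (λ v → bit-∧ (mayFollow a (value x)) (chain (value x) v)) ⟩
    arrangementSum n ys (λ v → bit (mayFollow a (value x)) * bit (chain (value x) v))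
      ≡⟨ arrangementSum-*ˡ n ys (bit (mayFollow a (value x))) (bit ∘ chain (value x)) ⟩
    bit (mayFollow a (value x)) * arrangementSum n ys (bit ∘ chain (value x))
      ≡⟨ cong (bit (mayFollow a (value x)) *_) (arrangementSum-chain n (value x) ys) ⟩
    matrix mayFollow a (value x) * words (value x) n (map value ys) ∎)
  (sym (pickSum-map value (λ b l → matrix mayFollow a b * words b n l) xs))

-- `p` is arbitrary so that it can be the condition local to `isDumontDerangement`, and `f` is
-- arbitrary because the induction passes to `f ∘ suc`.
allB-dumont : ∀ k (v : Vec (Fin m) n) (f : Fin n → A) (p : A → Bool) →
  (∀ i → p (f i) ≡ strict (k + toℕ i) (value (lookup v i))) →
  allB p (Vec.tabulate f) ≡ dumont k v
allB-dumont k []      f p eq = refl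
allB-dumont k (x ∷ v) f p eq = cong₂ _∧_
  (≡.trans (eq zero) (cong (λ j → strict j (value x)) (+-identityʳ k)))
  (allB-dumont (suc k) v (f ∘ suc) p λ i →
    ≡.trans (eq (suc i)) (cong (λ j → strict j (value (lookup v i))) (+-suc k (toℕ i))))

adjacent : List (Fin m) → Bool
adjacent []          = true
adjacent (x ∷ [])    = true
adjacent (x ∷ y ∷ l) = mayFollow (value x) (value y) ∧ adjacent (y ∷ l)

adjacent-toList : (v : Vec (Fin m) n) → adjacent (toList v) ≡ chain 0 v
adjacent-toList []      = refl
adjacent-toList (x ∷ v) = from x v
  where
  from : ∀ x (v : Vec (Fin m) n) → adjacent (x ∷ toList v) ≡ chain (value x) v
  from x []      = refl
  from x (y ∷ v) = cong (mayFollow (value x) (value y) ∧_) (from y v)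

-- The underscores stand for functions local to the definitions of
-- isDumontDerangement and descentsEvenOdd, which cannot be named here.
mutual
  isDumontDerangement≡dumont : (v : Vec (Fin m) m) → isDumontDerangement v ≡ dumont 1 v
  isDumontDerangement≡dumont v = allB-dumont 1 v id _ (condition v)

  condition : (v : Vec (Fin m) m) (i : Fin m) → _ ≡ strict (pos i) (val v i)
  condition v i with even (pos i)
  ... | true  = refl
  ... | false = refl

mutual
  descentsEvenOdd≡chain : (v : Vec (Fin m) m) → descentsEvenOdd v ≡ chain 0 v
  descentsEvenOdd≡chain {zero}  []      = refl
  -- Replacing `toList v` by an arbitrary list makes an induction possible, while `v` stays fixed as
  -- a parameter of the local function.
  descentsEvenOdd≡chain {suc m} v with toList v | adjacent-toList v
  ... | l | eq = ≡.trans (go≡adjacent v l) eq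

  go≡adjacent : (v : Vec (Fin (suc m)) (suc m)) (l : List (Fin (suc m))) → _ ≡ adjacent l
  go≡adjacent v []          = refl
  go≡adjacent v (x ∷ [])    = refl
  go≡adjacent v (x ∷ y ∷ l) = cong (mayFollow (value x) (value y) ∧_) (go≡adjacent v (y ∷ l))

-- The sizes are written `n * 2` because `suc n * 2` computes to `2 + n * 2`, the size at which the
-- forced positions are removed.
evenOddPerms↔dumontPerms : ∀ n →
  PermsWith (n * 2) descentsEvenOdd ↔ PermsWith (suc n * 2) isDumontDerangement
evenOddPerms↔dumontPerms n = ↔-trans (PermsWith↔Fin (n * 2) descentsEvenOdd)
  (↔-trans (subst (λ k → Fin evenOddCount ↔ Fin k) counts ↔-refl)
           (↔-sym (PermsWith↔Fin (suc n * 2) isDumontDerangement)))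
  where
  evenOddCount : ℕ
  evenOddCount = arrangementSum (n * 2) (allFin (n * 2)) (bit ∘ descentsEvenOdd)

  counts : evenOddCount ≡
           arrangementSum (suc n * 2) (allFin (suc n * 2)) (bit ∘ isDumontDerangement)
  counts = begin
    arrangementSum (n * 2) (allFin (n * 2)) (bit ∘ descentsEvenOdd)
      ≡⟨ arrangementSum-cong (n * 2) (allFin (n * 2)) (cong bit ∘ descentsEvenOdd≡chain) ⟩
    arrangementSum (n * 2) (allFin (n * 2)) (bit ∘ chain 0)
      ≡⟨ arrangementSum-chain (n * 2) 0 (allFin (n * 2)) ⟩
    words 0 (n * 2) (map value (allFin (n * 2)))
      ≡⟨ cong (words 0 (n * 2)) (map-value-allFin (n * 2)) ⟩
    words 0 (n * 2) (range 1 (n * 2))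
      ≡⟨ per-range≡words (n * 2) ⟨
    per (matrix mayFollow) (range 1 (n * 2)) (range 1 (n * 2))
      ≡⟨ per-mayFollow≡per-weak n ⟩
    per (matrix weak) (range 1 (n * 2)) (range 1 (n * 2))
      ≡⟨ per-strict≡per-weak n ⟨
    per (matrix strict) (range 1 (suc n * 2)) (range 1 (suc n * 2))
      ≡⟨ cong (per (matrix strict) (range 1 (suc n * 2))) (map-value-allFin (suc n * 2)) ⟨
    per (matrix strict) (range 1 (suc n * 2)) (map value (allFin (suc n * 2)))
      ≡⟨ per-map-columns (range 1 (suc n * 2)) (allFin (suc n * 2)) ⟩
    per (λ r x → matrix strict r (value x)) (range 1 (suc n * 2)) (allFin (suc n * 2))
      ≡⟨ arrangementSum-dumont (suc n * 2) 1 (allFin (suc n * 2)) (length-tabulate id) ⟨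
    arrangementSum (suc n * 2) (allFin (suc n * 2)) (bit ∘ dumont 1)
      ≡⟨ arrangementSum-cong (suc n * 2) (allFin (suc n * 2)) (cong bit ∘ isDumontDerangement≡dumont) ⟨
    arrangementSum (suc n * 2) (allFin (suc n * 2)) (bit ∘ isDumontDerangement) ∎
    where
    per-map-columns : ∀ rs (xs : List (Fin m)) →
      per (matrix strict) rs (map value xs) ≡ per (λ r x → matrix strict r (value x)) rs xs
    per-map-columns rs xs = ≡.trans
      (cong (λ rs → per (matrix strict) rs (map value xs)) (sym (map-id rs)))
      (per-map (matrix strict) id value rs xs)

theorem3p8 : (n : ℕ) → n ≥ 1 → HasCardinality-h n (EvenOddDescentPerms n)
theorem3p8 n _ = subst₂ (λ a b → PermsWith a descentsEvenOdd ↔ PermsWith b isDumontDerangement)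
  (*-comm n 2) (*-comm (suc n) 2) (evenOddPerms↔dumontPerms n)
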